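{- Let $p\equiv 1\pmod 4$ be a prime, let $m\in\{1,\dots,p-1\}$ be a quadratic non-residue modulo $p$, and let $M$ be any positive integer with $M\equiv m\pmod p$. Then $$-M\,F(M)\equiv \left[\frac{M}{p}\right]+\sum_{j=1}^{m-1}H_{\left[\frac{pj}{m}\right]}\pmod p .$$
   Context: $[x]$ denotes the floor of $x$. For an integer $a$ prime to $p$, $F(a)=\frac{a^{p-1}-1}{p}$ is the Fermat quotient. $H_k=\sum_{j=1}^k \frac1j$ is the $k$-th harmonic number, with $H_0=0$. Congruences modulo $p$ between rational numbers whose denominators are prime to $p$ are understood in the localization $\mathbb{Z}_{(p)}$. -}

module Defs where

open import Data.Integer.Base as ℤ using (ℤ; +_; 1ℤ)
open import Data.Nat.Base as ℕ using (ℕ; zero; suc; NonZero; _∸_)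
open import Data.Nat.Coprimality using (Coprime)
open import Data.Nat.DivMod using (_%_)
open import Data.Product.Base using (∃-syntax; _×_)
open import Data.Rational.Base as ℚ using (ℚ; 0ℚ; ↧ₙ_)
open import Relation.Binary.PropositionalEquality.Core using (_≡_)
open import Relation.Nullary.Negation.Core using (¬_)

fromℕ : ℕ → ℚ
fromℕ n = + n ℚ./ 1

-- Values of ℚ are always in lowest terms, so for p prime this is membership
-- in ℤ₍ₚ₎.
_∈ℤ₍_₎ : ℚ → ℕ → Set
x ∈ℤ₍ p ₎ = Coprime (↧ₙ x) p

infix 4 _≡_[mod_]

_≡_[mod_] : ℚ → ℚ → ℕ → Set
x ≡ y [mod p ] =
  x ∈ℤ₍ p ₎ × y ∈ℤ₍ p ₎ × ∃[ z ] (z ∈ℤ₍ p ₎ × x ℚ.- y ≡ fromℕ p ℚ.* z)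

-- ∑₁ n f is f 1 + f 2 + ⋯ + f n.
∑₁ : ℕ → (ℕ → ℚ) → ℚ
∑₁ zero    f = 0ℚ
∑₁ (suc n) f = ∑₁ n f ℚ.+ f (suc n)

H : ℕ → ℚ
H zero    = 0ℚ
H (suc k) = H k ℚ.+ 1ℤ ℚ./ suc k

-- The quotient is taken in ℚ, so it is exact for every a; it is an integer
-- when p is prime and does not divide a.
F : (p : ℕ) .{{_ : NonZero p}} → ℤ → ℚ
F p a = (a ℤ.^ (p ∸ 1) ℤ.- 1ℤ) ℚ./ p

QuadraticNonResidue : (p : ℕ) .{{_ : NonZero p}} → ℕ → Set
QuadraticNonResidue p m = Coprime m p × ¬ (∃[ x ] (x ℕ.* x) % p ≡ m % p)

{-# OPTIONS --safe #-}

-- For 0 < k < p write M k = q_k p + r_k with q_k = [M k / p]. The r_k permute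
-- 1, …, p − 1, so M^(p−1) = ∏ (M k / r_k) = ∏ (1 + p q_k / r_k), which modulo p²
-- is 1 + p ∑ q_k / r_k. Since M / r_k ≡ 1 / k, this gives Lerch's congruence
-- M F(M) ≡ ∑ q_k / k (mod p). With M = m + t p one has q_k = [m k / p] + t k, and
-- the t k contribute (p − 1) t ≡ −t. For the rest, k ≤ [p j / m] holds exactly
-- when j > [m k / p], so counting pairs (j, k) gives
-- ∑_j H_[pj/m] = ∑_k (m − 1 − [m k / p]) / k, where H_{p−1} ≡ 0 because p is odd.

module Submission where

open import Defs
open import Algebra.Bundles using (CommutativeRing)
open import Data.Bool.Base using (Bool; true; false; not)
open import Data.Fin.Base using (Fin; zero; suc; toℕ; inject₁; fromℕ<; opposite)
import Data.Fin.Base as Fin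
import Data.Fin.Properties as Fin
open import Data.Fin.Permutation as Permutation using (Permutation′; _⟨$⟩ʳ_)
open import Data.Integer.Base as ℤ using (ℤ; +_; 1ℤ)
import Data.Integer.Properties as ℤ
open import Data.Nat.Base as ℕ using (ℕ; zero; suc; pred; NonZero; _<_; _≤_; _<ᵇ_; _∸_; _*_; s≤s; z≤n)
open import Data.Nat.Coprimality as Coprimality using (Coprime)
open import Data.Nat.Divisibility as ℕ using (_∣_; divides)
open import Data.Nat.DivMod as ℕ using (_/_; _%_)
open import Data.Nat.GCD using (module Bézout)
open import Data.Nat.Primality using (Prime; prime)
import Data.Nat.Properties as ℕ
open import Data.Nat.Solver renaming (module +-*-Solver to ℕ-Solver)
open import Data.Product.Base using (∃-syntax; _×_; _,_; proj₁; proj₂; map; map₂)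
import Data.Rational.Base as ℚ
open ℚ using (ℚ; 0ℚ; 1ℚ; ↧ₙ_)
import Data.Rational.Properties as ℚ
open import Data.Rational.Solver using (module +-*-Solver)
import Data.Rational.Unnormalised.Base as ℚᵘ
import Data.Rational.Unnormalised.Properties as ℚᵘ
open import Function.Base using (_∘_)
open import Relation.Binary.PropositionalEquality
open import Relation.Nullary.Negation using (contradiction)
open import Relation.Nullary.Reflects using (ofʸ; ofⁿ)

open import Algebra.Properties.Semiring.Sum (CommutativeRing.semiring ℚ.+-*-commutativeRing)
  using (sum; sum-syntax; sum-cong-≗; sum-replicate-zero; sum-init-last;
         ∑-distrib-+; ∑-comm; ∑-permute; *-distribˡ-sum; *-distribʳ-sum)
open import Algebra.Properties.CommutativeMonoid.Sum ℚ.*-1-commutativeMonoid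
  using ()
  renaming (sum to product; sum-cong-≗ to product-cong-≗;
            ∑-distrib-+ to product-distrib-*; ∑-permute to product-permute)

-- Integers and unit fractions inside ℚ.

fromℤ : ℤ → ℚ
fromℤ i = i ℚ./ 1

toℚᵘ-/ : ∀ i d → ℚ.toℚᵘ (i ℚ./ suc d) ℚᵘ.≃ ℚᵘ.mkℚᵘ i d
toℚᵘ-/ i d = ℚ.toℚᵘ-fromℚᵘ (ℚᵘ.mkℚᵘ i d)

fromℤ-+ : ∀ i j → fromℤ (i ℤ.+ j) ≡ fromℤ i ℚ.+ fromℤ j
fromℤ-+ i j = ℚ.toℚᵘ-injective (begin
  ℚ.toℚᵘ (fromℤ (i ℤ.+ j))                 ≈⟨ toℚᵘ-/ (i ℤ.+ j) 0 ⟩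
  ℚᵘ.mkℚᵘ (i ℤ.+ j) 0
    ≡⟨ cong (λ k → ℚᵘ.mkℚᵘ k 0) (cong₂ ℤ._+_ (ℤ.*-identityʳ i) (ℤ.*-identityʳ j)) ⟨
  ℚᵘ.mkℚᵘ i 0 ℚᵘ.+ ℚᵘ.mkℚᵘ j 0             ≈⟨ ℚᵘ.+-cong (toℚᵘ-/ i 0) (toℚᵘ-/ j 0) ⟨
  ℚ.toℚᵘ (fromℤ i) ℚᵘ.+ ℚ.toℚᵘ (fromℤ j)   ≈⟨ ℚ.toℚᵘ-homo-+ (fromℤ i) (fromℤ j) ⟨
  ℚ.toℚᵘ (fromℤ i ℚ.+ fromℤ j)             ∎)
  where
  open ℚᵘ.≃-Reasoning

fromℤ-* : ∀ i j → fromℤ (i ℤ.* j) ≡ fromℤ i ℚ.* fromℤ j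
fromℤ-* i j = ℚ.toℚᵘ-injective (begin
  ℚ.toℚᵘ (fromℤ (i ℤ.* j))                 ≈⟨ toℚᵘ-/ (i ℤ.* j) 0 ⟩
  ℚᵘ.mkℚᵘ i 0 ℚᵘ.* ℚᵘ.mkℚᵘ j 0             ≈⟨ ℚᵘ.*-cong (toℚᵘ-/ i 0) (toℚᵘ-/ j 0) ⟨
  ℚ.toℚᵘ (fromℤ i) ℚᵘ.* ℚ.toℚᵘ (fromℤ j)   ≈⟨ ℚ.toℚᵘ-homo-* (fromℤ i) (fromℤ j) ⟨
  ℚ.toℚᵘ (fromℤ i ℚ.* fromℤ j)             ∎)
  where
  open ℚᵘ.≃-Reasoning

fromℕ-+ : ∀ a b → fromℕ (a ℕ.+ b) ≡ fromℕ a ℚ.+ fromℕ b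
fromℕ-+ a b = fromℤ-+ (+ a) (+ b)

fromℕ-* : ∀ a b → fromℕ (a * b) ≡ fromℕ a ℚ.* fromℕ b
fromℕ-* a b = trans (cong fromℤ (ℤ.pos-* a b)) (fromℤ-* (+ a) (+ b))

[1+d]*[i/[1+d]]≡i : ∀ i d → fromℕ (suc d) ℚ.* (i ℚ./ suc d) ≡ fromℤ i
[1+d]*[i/[1+d]]≡i i d = ℚ.toℚᵘ-injective (begin
  ℚ.toℚᵘ (fromℕ (suc d) ℚ.* (i ℚ./ suc d))              ≈⟨ ℚ.toℚᵘ-homo-* (fromℕ (suc d)) (i ℚ./ suc d) ⟩
  ℚ.toℚᵘ (fromℕ (suc d)) ℚᵘ.* ℚ.toℚᵘ (i ℚ./ suc d)      ≈⟨ ℚᵘ.*-cong (toℚᵘ-/ (+ suc d) 0) (toℚᵘ-/ i d) ⟩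
  ℚᵘ.mkℚᵘ (+ suc d) 0 ℚᵘ.* ℚᵘ.mkℚᵘ i d                  ≈⟨ ℚᵘ.*≡* lem ⟩
  ℚᵘ.mkℚᵘ i 0                                           ≈⟨ toℚᵘ-/ i 0 ⟨
  ℚ.toℚᵘ (fromℤ i)                                      ∎)
  where
  open ℚᵘ.≃-Reasoning
  lem : (+ suc d ℤ.* i) ℤ.* + 1 ≡ i ℤ.* (+ suc (d ℕ.+ 0))
  lem = trans (ℤ.*-identityʳ _) (trans (ℤ.*-comm (+ suc d) i) (cong (λ k → i ℤ.* + suc k) (sym (ℕ.+-identityʳ d))))

1/1+_ : ℕ → ℚ
1/1+ k = 1ℤ ℚ./ suc k

1+k*1/1+k≡1 : ∀ k → fromℕ (suc k) ℚ.* 1/1+ k ≡ 1ℚ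
1+k*1/1+k≡1 = [1+d]*[i/[1+d]]≡i 1ℤ

-- A power becomes a constant product over `Fin n`, so that M^(p-1) can be compared factor by factor
-- with products over the residues.
fromℤ-^ : ∀ i n → fromℤ (i ℤ.^ n) ≡ product {n} (λ _ → fromℤ i)
fromℤ-^ i zero    = refl
fromℤ-^ i (suc n) = trans (fromℤ-* i (i ℤ.^ n)) (cong (fromℤ i ℚ.*_) (fromℤ-^ i n))

-- The ring ℤ₍ₚ₎ and expansion modulo p².

coprime-* : ∀ {a b n} → Coprime a n → Coprime b n → Coprime (a * b) n
coprime-* {a} ca cb {d} (d∣ab , d∣n) = cb (Coprimality.coprime-divisor d⊥a d∣ab , d∣n)
  where
  d⊥a : Coprime d a
  d⊥a (e∣d , e∣a) = ca (e∣a , ℕ.∣-trans e∣d d∣n)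

coprime-∣ : ∀ {a b n} → a ∣ b → Coprime b n → Coprime a n
coprime-∣ a∣b cb (d∣a , d∣n) = cb (ℕ.∣-trans d∣a a∣b , d∣n)

-- Equations of this shape describe the reduced denominator of a quotient, a sum or a product, with
-- g the cancelled factor and d the unreduced denominator. Integrality then passes along
-- divisibility of denominators.
↧ₙ-∣ : ∀ x {g d} → ℚ.↧ x ℤ.* g ≡ + d → ↧ₙ x ∣ d
↧ₙ-∣ x {g} {d} eq = divides ℤ.∣ g ∣ (begin
  d                            ≡⟨ cong ℤ.∣_∣ eq ⟨
  ℤ.∣ ℚ.↧ x ℤ.* g ∣            ≡⟨ ℤ.abs-* (ℚ.↧ x) g ⟩
  ↧ₙ x * ℤ.∣ g ∣               ≡⟨ ℕ.*-comm (↧ₙ x) ℤ.∣ g ∣ ⟩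
  ℤ.∣ g ∣ * ↧ₙ x               ∎)
  where
  open ≡-Reasoning

module Localization (p : ℕ) where

  P : ℚ
  P = fromℕ p

  -- A record rather than x ∈ℤ₍ p ₎ itself, from which unification cannot recover x.
  record Integral (x : ℚ) : Set where
    constructor integral
    field ∈ℤ₍p₎ : x ∈ℤ₍ p ₎

  open Integral public

  /-integral : ∀ i d .{{_ : NonZero d}} → Coprime d p → Integral (i ℚ./ d)
  /-integral i d d⊥p = integral (coprime-∣ (↧ₙ-∣ (i ℚ./ d) (ℚ.↧-/ i d)) d⊥p)

  fromℤ-integral : ∀ i → Integral (fromℤ i)
  fromℤ-integral i = /-integral i 1 (Coprimality.1-coprimeTo p)

  fromℕ-integral : ∀ k → Integral (fromℕ k)
  fromℕ-integral k = fromℤ-integral (+ k)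

  +-integral : ∀ {x y} → Integral x → Integral y → Integral (x ℚ.+ y)
  +-integral {x} {y} (integral x∈) (integral y∈) =
    integral (coprime-∣ (↧ₙ-∣ (x ℚ.+ y) (ℚ.↧-+ x y)) (coprime-* {↧ₙ x} {↧ₙ y} x∈ y∈))

  *-integral : ∀ {x y} → Integral x → Integral y → Integral (x ℚ.* y)
  *-integral {x} {y} (integral x∈) (integral y∈) =
    integral (coprime-∣ (↧ₙ-∣ (x ℚ.* y) (ℚ.↧-* x y)) (coprime-* {↧ₙ x} {↧ₙ y} x∈ y∈))

  neg-integral : ∀ {x} → Integral x → Integral (ℚ.- x)
  neg-integral {x} (integral x∈) = integral (subst (λ d → Coprime d p) (sym (cong ℤ.∣_∣ (ℚ.↧-neg x))) x∈)

  sum-integral : ∀ {n} (f : Fin n → ℚ) → (∀ i → Integral (f i)) → Integral (sum f)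
  sum-integral {zero}  f f∈ = fromℕ-integral 0
  sum-integral {suc n} f f∈ = +-integral (f∈ zero) (sum-integral (f ∘ suc) (f∈ ∘ suc))

  -- In (1 + p a)(1 + p (s + p z)) the first-order part is p (a + s). The cross term a (s + p z)
  -- carries p², so it is absorbed into z. Keeping the remainder as an explicit element of ℤ₍ₚ₎ lets
  -- all later steps be equations in ℚ.
  product-1+Pa : ∀ {n} (a : Fin n → ℚ) → (∀ i → Integral (a i)) →
    ∃[ z ] (Integral z × product (λ i → 1ℚ ℚ.+ P ℚ.* a i) ≡ 1ℚ ℚ.+ P ℚ.* (sum a ℚ.+ P ℚ.* z))
  product-1+Pa {zero} a a∈ = 0ℚ , fromℕ-integral 0 ,
    solve 1 (λ p → con 1ℚ := con 1ℚ :+ p :* (con 0ℚ :+ p :* con 0ℚ)) refl P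
    where
    open +-*-Solver
  product-1+Pa {suc n} a a∈ with product-1+Pa (a ∘ suc) (a∈ ∘ suc)
  ... | z , z∈ , eq = z′ , z′∈ , trans (cong ((1ℚ ℚ.+ P ℚ.* a₀) ℚ.*_) eq)
      (solve 4 (λ p a s z → (con 1ℚ :+ p :* a) :* (con 1ℚ :+ p :* (s :+ p :* z))
                := con 1ℚ :+ p :* ((a :+ s) :+ p :* (z :+ a :* (s :+ p :* z)))) refl P a₀ s z)
    where
    open +-*-Solver
    a₀ = a zero
    s = sum (a ∘ suc)
    z′ = z ℚ.+ a₀ ℚ.* (s ℚ.+ P ℚ.* z)
    z′∈ : Integral z′
    z′∈ = +-integral z∈ (*-integral (a∈ zero) (+-integral (sum-integral (a ∘ suc) (a∈ ∘ suc)) (*-integral (fromℕ-integral p) z∈)))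

-- Finite sums, harmonic numbers and indicators.

sum-const : ∀ n x → ∑[ i < n ] x ≡ fromℕ n ℚ.* x
sum-const zero    x = sym (ℚ.*-zeroˡ x)
sum-const (suc n) x = begin
  x ℚ.+ ∑[ i < n ] x          ≡⟨ cong (x ℚ.+_) (sum-const n x) ⟩
  x ℚ.+ fromℕ n ℚ.* x         ≡⟨ solve 2 (λ x y → x :+ y :* x := (con 1ℚ :+ y) :* x) refl x (fromℕ n) ⟩
  (1ℚ ℚ.+ fromℕ n) ℚ.* x      ≡⟨ cong (ℚ._* x) (fromℕ-+ 1 n) ⟨
  fromℕ (suc n) ℚ.* x         ∎
  where
  open ≡-Reasoning
  open +-*-Solver

∑₁≡∑ : ∀ n f → ∑₁ n f ≡ ∑[ i < n ] f (suc (toℕ i))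
∑₁≡∑ zero    f = refl
∑₁≡∑ (suc n) f = sym (begin
  -- `∑₁` recurses on the last term and `sum` on the first, hence `sum-init-last`.
  ∑[ i < suc n ] f (suc (toℕ i))         ≡⟨ sum-init-last {n} (λ i → f (suc (toℕ i))) ⟩
  ∑[ i < n ] f (suc (toℕ (inject₁ i))) ℚ.+ f (suc (toℕ (Fin.fromℕ n)))
    ≡⟨ cong₂ ℚ._+_ (sum-cong-≗ {n} (λ i → cong (f ∘ suc) (Fin.toℕ-inject₁ i))) (cong (f ∘ suc) (Fin.toℕ-fromℕ n)) ⟩
  ∑[ i < n ] f (suc (toℕ i)) ℚ.+ f (suc n)  ≡⟨ cong (ℚ._+ f (suc n)) (∑₁≡∑ n f) ⟨
  ∑₁ n f ℚ.+ f (suc n)                   ∎)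
  where
  open ≡-Reasoning

H≡∑ : ∀ n → H n ≡ ∑[ i < n ] 1/1+ (toℕ i)
H≡∑ n = trans (H≡∑₁ n) (∑₁≡∑ n (λ k → 1/1+ (pred k)))
  where
  H≡∑₁ : ∀ n → H n ≡ ∑₁ n (λ k → 1/1+ (pred k))
  H≡∑₁ zero    = refl
  H≡∑₁ (suc n) = cong (ℚ._+ 1/1+ n) (H≡∑₁ n)

𝟙 : Bool → ℚ
𝟙 true  = 1ℚ
𝟙 false = 0ℚ

𝟙-not : ∀ b → 𝟙 (not b) ≡ 1ℚ ℚ.- 𝟙 b
𝟙-not true  = refl
𝟙-not false = refl

-- Pads harmonic sums whose lengths depend on j to one common range, so that the order of summation
-- can be exchanged.
sum-extend : ∀ {n N} → n ≤ N → (f : ℕ → ℚ) →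
  ∑[ i < n ] f (toℕ i) ≡ ∑[ i < N ] (𝟙 (toℕ i <ᵇ n) ℚ.* f (toℕ i))
sum-extend {N = N} z≤n f =
  sym (trans (sum-cong-≗ {N} (λ i → ℚ.*-zeroˡ (f (toℕ i)))) (sum-replicate-zero N))
sum-extend (s≤s n≤N) f = cong₂ ℚ._+_ (sym (ℚ.*-identityˡ (f 0))) (sum-extend n≤N (f ∘ suc))

-- Index 0 lies below `suc s`, so its term is 1 - 1 = 0; dropping it lowers s and L together until s
-- = 0, where every term is 1.
sum-≮ : ∀ {s L} → s ≤ L → ∑[ j < L ] (1ℚ ℚ.- 𝟙 (toℕ j <ᵇ s)) ≡ fromℕ L ℚ.- fromℕ s
sum-≮ {L = L} z≤n = trans (sum-const L 1ℚ) (solve 1 (λ x → x :* con 1ℚ := x :- con 0ℚ) refl (fromℕ L))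
  where
  open +-*-Solver
sum-≮ {suc s} {suc L} (s≤s s≤L) = begin
  0ℚ ℚ.+ ∑[ j < L ] (1ℚ ℚ.- 𝟙 (toℕ j <ᵇ s))         ≡⟨ cong (0ℚ ℚ.+_) (sum-≮ s≤L) ⟩
  0ℚ ℚ.+ (fromℕ L ℚ.- fromℕ s)
    ≡⟨ solve 2 (λ l s → con 0ℚ :+ (l :- s) := (con 1ℚ :+ l) :- (con 1ℚ :+ s)) refl (fromℕ L) (fromℕ s) ⟩
  (1ℚ ℚ.+ fromℕ L) ℚ.- (1ℚ ℚ.+ fromℕ s)             ≡⟨ cong₂ ℚ._-_ (fromℕ-+ 1 L) (fromℕ-+ 1 s) ⟨
  fromℕ (suc L) ℚ.- fromℕ (suc s)                   ∎
  where
  open ≡-Reasoning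
  open +-*-Solver

-- Floors, and multiplication by a unit as a permutation of the nonzero residues.

≤/⇒*≤ : ∀ {k m n} .{{_ : NonZero n}} → k ≤ m / n → k * n ≤ m
≤/⇒*≤ {k} {m} {n} k≤m/n = ℕ.≤-trans (ℕ.*-monoˡ-≤ n k≤m/n) (ℕ.m/n*n≤m m n)

*≤⇒≤/ : ∀ {k m n} .{{_ : NonZero n}} → k * n ≤ m → k ≤ m / n
*≤⇒≤/ {k} {m} {n} k*n≤m = ℕ.≤-trans (ℕ.≤-reflexive (sym (ℕ.m*n/n≡m k n))) (ℕ./-monoˡ-≤ n k*n≤m)

invert-mod : ∀ {a n} → Coprime a (suc n) → ∃[ b ] (a * b) % suc n ≡ 1 % suc n
invert-mod {a} {n} a⊥p with Coprimality.coprime-Bézout a⊥p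
... | Bézout.+- x y eq = x , (begin
  (a * x) % suc n            ≡⟨ cong (_% suc n) (trans (ℕ.*-comm a x) (sym eq)) ⟩
  (1 ℕ.+ y * suc n) % suc n  ≡⟨ ℕ.[m+kn]%n≡m%n 1 y (suc n) ⟩
  1 % suc n                  ∎)
  where
  open ≡-Reasoning
-- n ≡ −1, so x * n stands for −x.
... | Bézout.-+ x y eq = x * n , (begin
  (a * (x * n)) % suc n                  ≡⟨ ℕ.[m+n]%n≡m%n (a * (x * n)) (suc n) ⟨
  (a * (x * n) ℕ.+ suc n) % suc n
    ≡⟨ cong (_% suc n) (solve 3 (λ a x n → a :* (x :* n) :+ (con 1 :+ n) := con 1 :+ n :* (con 1 :+ x :* a)) refl a x n) ⟩
  (1 ℕ.+ n * (1 ℕ.+ x * a)) % suc n      ≡⟨ cong (λ w → (1 ℕ.+ n * w) % suc n) eq ⟩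
  (1 ℕ.+ n * (y * suc n)) % suc n        ≡⟨ cong (λ w → (1 ℕ.+ w) % suc n) (ℕ.*-assoc n y (suc n)) ⟨
  (1 ℕ.+ n * y * suc n) % suc n          ≡⟨ ℕ.[m+kn]%n≡m%n 1 (n * y) (suc n) ⟩
  1 % suc n                              ∎)
  where
  open ≡-Reasoning
  open ℕ-Solver

module _ {n : ℕ} where

  -- Serves twice: it shows that the residues of the multiples of a are nonzero, and that
  -- multiplication by b undoes multiplication by a.
  *-cancel-mod : ∀ a b → (a * b) % suc n ≡ 1 % suc n → ∀ {k} → k < suc n → (b * ((a * k) % suc n)) % suc n ≡ k
  *-cancel-mod a b ab≡1 {k} k<p = begin
    (b * ((a * k) % p)) % p               ≡⟨ ℕ.%-distribˡ-* b ((a * k) % p) p ⟩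
    ((b % p) * (((a * k) % p) % p)) % p   ≡⟨ cong (λ w → ((b % p) * w) % p) (ℕ.m%n%n≡m%n (a * k) p) ⟩
    ((b % p) * ((a * k) % p)) % p         ≡⟨ ℕ.%-distribˡ-* b (a * k) p ⟨
    (b * (a * k)) % p                     ≡⟨ cong (_% p) (trans (sym (ℕ.*-assoc b a k)) (cong (_* k) (ℕ.*-comm b a))) ⟩
    (a * b * k) % p                       ≡⟨ ℕ.%-distribˡ-* (a * b) k p ⟩
    (((a * b) % p) * (k % p)) % p         ≡⟨ cong (λ w → (w * (k % p)) % p) ab≡1 ⟩
    ((1 % p) * (k % p)) % p               ≡⟨ ℕ.%-distribˡ-* 1 k p ⟨
    (1 * k) % p                           ≡⟨ cong (_% p) (ℕ.*-identityˡ k) ⟩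
    k % p                                 ≡⟨ ℕ.m<n⇒m%n≡m k<p ⟩
    k                                     ∎
    where
    open ≡-Reasoning
    p = suc n

  module _ (a b : ℕ) (ab≡1 : (a * b) % suc n ≡ 1 % suc n) (i : Fin n) where

    private
      r = (a * suc (toℕ i)) % suc n

      instance
        r≢0 : NonZero r
        -- If the residue were 0, multiplying back by b would give 0 instead of i + 1.
        r≢0 = ℕ.≢-nonZero λ r≡0 → contradiction
          (trans (sym (*-cancel-mod a b ab≡1 (s≤s (Fin.toℕ<n i)))) (cong (_% suc n) (trans (cong (b *_) r≡0) (ℕ.*-zeroʳ b))))
          λ ()

      pred[r]<n : pred r < n
      pred[r]<n = ℕ.s<s⁻¹ (subst (_< suc n) (sym (ℕ.suc-pred r)) (ℕ.m%n<n (a * suc (toℕ i)) (suc n)))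

    mulMod : Fin n
    mulMod = fromℕ< pred[r]<n

    suc-toℕ-mulMod : suc (toℕ mulMod) ≡ (a * suc (toℕ i)) % suc n
    suc-toℕ-mulMod = trans (cong suc (Fin.toℕ-fromℕ< pred[r]<n)) (ℕ.suc-pred r)

  mulMod-inverse : ∀ a b ab≡1 ba≡1 i → mulMod b a ba≡1 (mulMod a b ab≡1 i) ≡ i
  mulMod-inverse a b ab≡1 ba≡1 i = Fin.toℕ-injective (ℕ.suc-injective (begin
    suc (toℕ (mulMod b a ba≡1 j))              ≡⟨ suc-toℕ-mulMod b a ba≡1 j ⟩
    (b * suc (toℕ j)) % suc n                  ≡⟨ cong (λ r → (b * r) % suc n) (suc-toℕ-mulMod a b ab≡1 i) ⟩
    (b * ((a * suc (toℕ i)) % suc n)) % suc n  ≡⟨ *-cancel-mod a b ab≡1 (s≤s (Fin.toℕ<n i)) ⟩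
    suc (toℕ i)                                ∎))
    where
    open ≡-Reasoning
    j = mulMod a b ab≡1 i

  -- The inverse permutation is multiplication by an inverse of a obtained from Bézout's identity.
  multiplicationMod : ∀ {a} → Coprime a (suc n) →
    ∃[ π ] (∀ i → suc (toℕ (π ⟨$⟩ʳ i)) ≡ (a * suc (toℕ i)) % suc n)
  multiplicationMod {a} a⊥p with invert-mod a⊥p
  ... | b , ab≡1 = Permutation.permutation (mulMod a b ab≡1) (mulMod b a ba≡1)
        (mulMod-inverse b a ba≡1 ab≡1) (mulMod-inverse a b ab≡1 ba≡1)
      , suc-toℕ-mulMod a b ab≡1
    where
    ba≡1 : (b * a) % suc n ≡ 1 % suc n
    ba≡1 = trans (cong (_% suc n) (ℕ.*-comm b a)) ab≡1

-- An index i : Fin n stands for the residue i + 1 in 1, …, p − 1, where p = suc n.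
module ModPrime {n : ℕ} (p-prime : Prime (suc n)) where

  private
    p = suc n
  open Localization p

  -- Unit fractions modulo p and the vanishing of H (p - 1).

  K : Fin n → ℚ
  K i = fromℕ (suc (toℕ i))

  K⁻¹ : Fin n → ℚ
  K⁻¹ i = 1/1+ (toℕ i)

  K*K⁻¹≡1 : ∀ i → K i ℚ.* K⁻¹ i ≡ 1ℚ
  K*K⁻¹≡1 i = 1+k*1/1+k≡1 (toℕ i)

  1/1+-integral : ∀ k → k < n → Integral (1/1+ k)
  1/1+-integral k k<n = /-integral 1ℤ (suc k) (Coprimality.sym (Coprimality.prime⇒coprime p-prime (s≤s k<n)))

  K⁻¹-integral : ∀ i → Integral (K⁻¹ i)
  K⁻¹-integral i = 1/1+-integral (toℕ i) (Fin.toℕ<n i)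

  -- Under the shift by one, `opposite` is the reflection k ↦ p - k.
  K-opposite : ∀ i → K i ℚ.+ K (opposite i) ≡ P
  K-opposite i = begin
    K i ℚ.+ K (opposite i)                             ≡⟨ fromℕ-+ (suc (toℕ i)) (suc (toℕ (opposite i))) ⟨
    fromℕ (suc (toℕ i) ℕ.+ suc (toℕ (opposite i)))
      ≡⟨ cong (λ k → fromℕ (suc (toℕ i) ℕ.+ suc k)) (Fin.opposite-prop i) ⟩
    fromℕ (suc (toℕ i) ℕ.+ suc (n ∸ suc (toℕ i)))      ≡⟨ cong fromℕ (ℕ.+-suc (suc (toℕ i)) (n ∸ suc (toℕ i))) ⟩
    fromℕ (suc (suc (toℕ i) ℕ.+ (n ∸ suc (toℕ i))))    ≡⟨ cong (fromℕ ∘ suc) (ℕ.m+[n∸m]≡n (Fin.toℕ<n i)) ⟩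
    P                                                  ∎
    where
    open ≡-Reasoning

  -- This is 1/k + 1/(p - k) = p / (k (p - k)), with the denominators cleared through `K*K⁻¹≡1`.
  K⁻¹-opposite : ∀ i → K⁻¹ i ℚ.+ K⁻¹ (opposite i) ≡ P ℚ.* (K⁻¹ i ℚ.* K⁻¹ (opposite i))
  K⁻¹-opposite i = begin
    x ℚ.+ y                                   ≡⟨ cong₂ ℚ._+_ (sym (ℚ.*-identityʳ x)) (sym (ℚ.*-identityʳ y)) ⟩
    x ℚ.* 1ℚ ℚ.+ y ℚ.* 1ℚ
      ≡⟨ cong₂ (λ u v → x ℚ.* u ℚ.+ y ℚ.* v) (K*K⁻¹≡1 (opposite i)) (K*K⁻¹≡1 i) ⟨
    x ℚ.* (l ℚ.* y) ℚ.+ y ℚ.* (k ℚ.* x)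
      ≡⟨ solve 4 (λ x y k l → x :* (l :* y) :+ y :* (k :* x) := (k :+ l) :* (x :* y)) refl x y k l ⟩
    (k ℚ.+ l) ℚ.* (x ℚ.* y)                   ≡⟨ cong (ℚ._* (x ℚ.* y)) (K-opposite i) ⟩
    P ℚ.* (x ℚ.* y)                           ∎
    where
    open ≡-Reasoning
    open +-*-Solver
    x = K⁻¹ i
    y = K⁻¹ (opposite i)
    k = K i
    l = K (opposite i)

  -- Adding the sum to its reflection under k ↦ p - k makes every term a multiple of p. This gives
  -- twice the sum, and 2 < p puts 1/2 in ℤ₍ₚ₎.
  harmonic-sum : 2 < p → ∃[ z ] (Integral z × sum K⁻¹ ≡ P ℚ.* z)
  harmonic-sum 2<p = 1/1+ 1 ℚ.* T , *-integral (1/1+-integral 1 (ℕ.s<s⁻¹ 2<p)) T∈ , (begin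
    S                                            ≡⟨ solve 1 (λ s → s := con (1/1+ 1) :* (s :+ s)) refl S ⟩
    1/1+ 1 ℚ.* (S ℚ.+ S)
      ≡⟨ cong (λ w → 1/1+ 1 ℚ.* (S ℚ.+ w)) (∑-permute K⁻¹ Permutation.reverse) ⟩
    1/1+ 1 ℚ.* (S ℚ.+ sum (K⁻¹ ∘ opposite))      ≡⟨ cong (1/1+ 1 ℚ.*_) (∑-distrib-+ K⁻¹ (K⁻¹ ∘ opposite)) ⟨
    1/1+ 1 ℚ.* ∑[ i < n ] (K⁻¹ i ℚ.+ K⁻¹ (opposite i))
                                                 ≡⟨ cong (1/1+ 1 ℚ.*_) (trans (sum-cong-≗ K⁻¹-opposite) (sym (*-distribˡ-sum P t))) ⟩
    1/1+ 1 ℚ.* (P ℚ.* T)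
      ≡⟨ solve 2 (λ p t → con (1/1+ 1) :* (p :* t) := p :* (con (1/1+ 1) :* t)) refl P T ⟩
    P ℚ.* (1/1+ 1 ℚ.* T)                         ∎)
    where
    open ≡-Reasoning
    open +-*-Solver
    S = sum K⁻¹
    t : Fin n → ℚ
    t i = K⁻¹ i ℚ.* K⁻¹ (opposite i)
    T = sum t
    T∈ : Integral T
    T∈ = sum-integral t (λ i → *-integral (K⁻¹-integral i) (K⁻¹-integral (opposite i)))

  -- Lerch's congruence for the Fermat quotient.

  module _ (M : ℕ) (M⊥p : Coprime M p) where

    private
      q : Fin n → ℚ
      q i = fromℕ ((M * suc (toℕ i)) / p)

      π : Permutation′ n
      π = proj₁ (multiplicationMod M⊥p)

      suc-toℕ-π : ∀ i → suc (toℕ (π ⟨$⟩ʳ i)) ≡ (M * suc (toℕ i)) % p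
      suc-toℕ-π = proj₂ (multiplicationMod M⊥p)

      -- With k = i + 1, `R i` is the residue r_k of M k. The other two are p-coefficients: M k /
      -- r_k = 1 + p a and M a = q_k / k + p c.
      R R⁻¹ a c : Fin n → ℚ
      R i = K (π ⟨$⟩ʳ i)
      R⁻¹ i = K⁻¹ (π ⟨$⟩ʳ i)
      a i = q i ℚ.* R⁻¹ i
      c i = q i ℚ.* q i ℚ.* (R⁻¹ i ℚ.* K⁻¹ i)

      M*K≡R+q*P : ∀ i → fromℕ M ℚ.* K i ≡ R i ℚ.+ q i ℚ.* P
      M*K≡R+q*P i = begin
        fromℕ M ℚ.* K i                               ≡⟨ fromℕ-* M k ⟨
        fromℕ (M * k)                                 ≡⟨ cong fromℕ (ℕ.m≡m%n+[m/n]*n (M * k) p) ⟩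
        fromℕ ((M * k) % p ℕ.+ (M * k) / p * p)       ≡⟨ fromℕ-+ ((M * k) % p) ((M * k) / p * p) ⟩
        fromℕ ((M * k) % p) ℚ.+ fromℕ ((M * k) / p * p)
          ≡⟨ cong₂ ℚ._+_ (cong fromℕ (sym (suc-toℕ-π i))) (fromℕ-* ((M * k) / p) p) ⟩
        R i ℚ.+ q i ℚ.* P                             ∎
        where
        open ≡-Reasoning
        k = suc (toℕ i)

      q∈ : ∀ i → Integral (q i)
      q∈ i = fromℕ-integral ((M * suc (toℕ i)) / p)

      a∈ : ∀ i → Integral (a i)
      a∈ i = *-integral (q∈ i) (K⁻¹-integral (π ⟨$⟩ʳ i))

      M*K*R⁻¹≡1+P*a : ∀ i → fromℕ M ℚ.* K i ℚ.* R⁻¹ i ≡ 1ℚ ℚ.+ P ℚ.* a i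
      M*K*R⁻¹≡1+P*a i = begin
        fromℕ M ℚ.* K i ℚ.* R⁻¹ i         ≡⟨ cong (ℚ._* R⁻¹ i) (M*K≡R+q*P i) ⟩
        (R i ℚ.+ q i ℚ.* P) ℚ.* R⁻¹ i
          ≡⟨ solve 4 (λ r q p s → (r :+ q :* p) :* s := r :* s :+ p :* (q :* s)) refl (R i) (q i) P (R⁻¹ i) ⟩
        R i ℚ.* R⁻¹ i ℚ.+ P ℚ.* a i       ≡⟨ cong (ℚ._+ P ℚ.* a i) (K*K⁻¹≡1 (π ⟨$⟩ʳ i)) ⟩
        1ℚ ℚ.+ P ℚ.* a i                  ∎
        where
        open ≡-Reasoning
        open +-*-Solver

      -- Each factor M is written as M k · (1/k). Reindexing the product of the 1/k along `π` turns
      -- it into the product of the 1/r_k, and the factors regroup as M k / r_k.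
      product-M≡product-1+P*a : product {n} (λ _ → fromℕ M) ≡ product (λ i → 1ℚ ℚ.+ P ℚ.* a i)
      product-M≡product-1+P*a = begin
        product {n} (λ _ → fromℕ M)                             ≡⟨ product-cong-≗ M≡M*K*K⁻¹ ⟩
        product (λ i → fromℕ M ℚ.* K i ℚ.* K⁻¹ i)               ≡⟨ product-distrib-* (λ i → fromℕ M ℚ.* K i) K⁻¹ ⟩
        product (λ i → fromℕ M ℚ.* K i) ℚ.* product K⁻¹
          ≡⟨ cong (product (λ i → fromℕ M ℚ.* K i) ℚ.*_) (product-permute K⁻¹ π) ⟩
        product (λ i → fromℕ M ℚ.* K i) ℚ.* product R⁻¹         ≡⟨ product-distrib-* (λ i → fromℕ M ℚ.* K i) R⁻¹ ⟨
        product (λ i → fromℕ M ℚ.* K i ℚ.* R⁻¹ i)               ≡⟨ product-cong-≗ M*K*R⁻¹≡1+P*a ⟩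
        product (λ i → 1ℚ ℚ.+ P ℚ.* a i)                        ∎
        where
        open ≡-Reasoning
        M≡M*K*K⁻¹ : ∀ i → fromℕ M ≡ fromℕ M ℚ.* K i ℚ.* K⁻¹ i
        M≡M*K*K⁻¹ i = sym (trans (ℚ.*-assoc (fromℕ M) (K i) (K⁻¹ i))
          (trans (cong (fromℕ M ℚ.*_) (K*K⁻¹≡1 i)) (ℚ.*-identityʳ (fromℕ M))))

      P*F≡product-1 : P ℚ.* F p (+ M) ≡ product {n} (λ _ → fromℕ M) ℚ.- 1ℚ
      P*F≡product-1 = begin
        P ℚ.* F p (+ M)                                ≡⟨ [1+d]*[i/[1+d]]≡i ((+ M) ℤ.^ n ℤ.- 1ℤ) n ⟩
        fromℤ ((+ M) ℤ.^ n ℤ.- 1ℤ)                     ≡⟨ fromℤ-+ ((+ M) ℤ.^ n) ℤ.-1ℤ ⟩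
        fromℤ ((+ M) ℤ.^ n) ℚ.- 1ℚ                     ≡⟨ cong (ℚ._- 1ℚ) (fromℤ-^ (+ M) n) ⟩
        product {n} (λ _ → fromℕ M) ℚ.- 1ℚ             ∎
        where
        open ≡-Reasoning

      P*-cancel : ∀ {x y} → P ℚ.* x ≡ P ℚ.* y → x ≡ y
      P*-cancel {x} {y} Px≡Py = trans (sym (P⁻¹P x)) (trans (cong (1/1+ n ℚ.*_) Px≡Py) (P⁻¹P y))
        where
        P⁻¹P : ∀ x → 1/1+ n ℚ.* (P ℚ.* x) ≡ x
        P⁻¹P x = trans (sym (ℚ.*-assoc (1/1+ n) P x))
          (trans (cong (ℚ._* x) (trans (ℚ.*-comm (1/1+ n) P) (1+k*1/1+k≡1 n))) (ℚ.*-identityˡ x))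

      -- The expansion of M^(p-1) - 1 is known up to a multiple of p²; cancelling p leaves the
      -- Fermat quotient up to a multiple of p.
      F≡sum-a : ∃[ z ] (Integral z × F p (+ M) ≡ sum a ℚ.+ P ℚ.* z)
      F≡sum-a = map₂ (map₂ F≡) (product-1+Pa a a∈)
        where
        open ≡-Reasoning
        open +-*-Solver
        F≡ : ∀ {z} → product (λ i → 1ℚ ℚ.+ P ℚ.* a i) ≡ 1ℚ ℚ.+ P ℚ.* (sum a ℚ.+ P ℚ.* z) →
          F p (+ M) ≡ sum a ℚ.+ P ℚ.* z
        F≡ {z} eq = P*-cancel (begin
          P ℚ.* F p (+ M)                             ≡⟨ P*F≡product-1 ⟩
          product {n} (λ _ → fromℕ M) ℚ.- 1ℚ          ≡⟨ cong (ℚ._- 1ℚ) (trans product-M≡product-1+P*a eq) ⟩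
          1ℚ ℚ.+ P ℚ.* (sum a ℚ.+ P ℚ.* z) ℚ.- 1ℚ
            ≡⟨ solve 1 (λ x → con 1ℚ :+ x :- con 1ℚ := x) refl (P ℚ.* (sum a ℚ.+ P ℚ.* z)) ⟩
          P ℚ.* (sum a ℚ.+ P ℚ.* z)                   ∎)

      -- Dividing M k = r_k + q_k p by k r_k gives M / r_k = 1/k + p q_k / (k r_k); multiplying by
      -- q_k produces the exact error term `c i`.
      M*a≡q*K⁻¹+P*c : ∀ i → fromℕ M ℚ.* a i ≡ q i ℚ.* K⁻¹ i ℚ.+ P ℚ.* c i
      M*a≡q*K⁻¹+P*c i = begin
        fromℕ M ℚ.* (q i ℚ.* R⁻¹ i)
          ≡⟨ ℚ.*-identityʳ _ ⟨
        fromℕ M ℚ.* (q i ℚ.* R⁻¹ i) ℚ.* 1ℚ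
          ≡⟨ cong (fromℕ M ℚ.* (q i ℚ.* R⁻¹ i) ℚ.*_) (K*K⁻¹≡1 i) ⟨
        fromℕ M ℚ.* (q i ℚ.* R⁻¹ i) ℚ.* (K i ℚ.* K⁻¹ i)
          ≡⟨ solve 5 (λ m q s k l → m :* (q :* s) :* (k :* l) := q :* l :* s :* (m :* k)) refl (fromℕ M) (q i) (R⁻¹ i) (K i) (K⁻¹ i) ⟩
        q i ℚ.* K⁻¹ i ℚ.* R⁻¹ i ℚ.* (fromℕ M ℚ.* K i)
          ≡⟨ cong (q i ℚ.* K⁻¹ i ℚ.* R⁻¹ i ℚ.*_) (M*K≡R+q*P i) ⟩
        q i ℚ.* K⁻¹ i ℚ.* R⁻¹ i ℚ.* (R i ℚ.+ q i ℚ.* P)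
          ≡⟨ solve 5 (λ q l s r p → q :* l :* s :* (r :+ q :* p) := q :* l :* (r :* s) :+ p :* (q :* q :* (s :* l))) refl (q i) (K⁻¹ i) (R⁻¹ i) (R i) P ⟩
        q i ℚ.* K⁻¹ i ℚ.* (R i ℚ.* R⁻¹ i) ℚ.+ P ℚ.* c i
          ≡⟨ cong (λ w → q i ℚ.* K⁻¹ i ℚ.* w ℚ.+ P ℚ.* c i) (K*K⁻¹≡1 (π ⟨$⟩ʳ i)) ⟩
        q i ℚ.* K⁻¹ i ℚ.* 1ℚ ℚ.+ P ℚ.* c i
          ≡⟨ cong (ℚ._+ P ℚ.* c i) (ℚ.*-identityʳ (q i ℚ.* K⁻¹ i)) ⟩
        q i ℚ.* K⁻¹ i ℚ.+ P ℚ.* c i ∎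
        where
        open ≡-Reasoning
        open +-*-Solver

    -- Read off from the expansion; it amounts to Fermat's little theorem for M.
    F-integral : Integral (F p (+ M))
    F-integral = let z , z∈ , eq = F≡sum-a in
      subst Integral (sym eq) (+-integral (sum-integral a a∈) (*-integral (fromℕ-integral p) z∈))

    lerch : ∃[ z ] (Integral z ×
      fromℕ M ℚ.* F p (+ M) ≡ ∑[ i < n ] (fromℕ ((M * suc (toℕ i)) / p) ℚ.* 1/1+ (toℕ i)) ℚ.+ P ℚ.* z)
    lerch = map (λ z → sum c ℚ.+ fromℕ M ℚ.* z)
      (λ (z∈ , eq) → +-integral (sum-integral c c∈) (*-integral (fromℕ-integral M) z∈) , M*F≡ eq)
      F≡sum-a
      where
      open ≡-Reasoning
      open +-*-Solver
      M*sum-a : fromℕ M ℚ.* sum a ≡ sum (λ i → q i ℚ.* K⁻¹ i) ℚ.+ P ℚ.* sum c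
      M*sum-a = begin
        fromℕ M ℚ.* sum a                                         ≡⟨ *-distribˡ-sum (fromℕ M) a ⟩
        sum (λ i → fromℕ M ℚ.* a i)                               ≡⟨ sum-cong-≗ M*a≡q*K⁻¹+P*c ⟩
        sum (λ i → q i ℚ.* K⁻¹ i ℚ.+ P ℚ.* c i)
          ≡⟨ ∑-distrib-+ (λ i → q i ℚ.* K⁻¹ i) (λ i → P ℚ.* c i) ⟩
        sum (λ i → q i ℚ.* K⁻¹ i) ℚ.+ sum (λ i → P ℚ.* c i)
          ≡⟨ cong (sum (λ i → q i ℚ.* K⁻¹ i) ℚ.+_) (*-distribˡ-sum P c) ⟨
        sum (λ i → q i ℚ.* K⁻¹ i) ℚ.+ P ℚ.* sum c                 ∎
      c∈ : ∀ i → Integral (c i)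
      c∈ i = *-integral (*-integral (q∈ i) (q∈ i)) (*-integral (K⁻¹-integral (π ⟨$⟩ʳ i)) (K⁻¹-integral i))
      M*F≡ : ∀ {z} → F p (+ M) ≡ sum a ℚ.+ P ℚ.* z →
        fromℕ M ℚ.* F p (+ M) ≡ sum (λ i → q i ℚ.* K⁻¹ i) ℚ.+ P ℚ.* (sum c ℚ.+ fromℕ M ℚ.* z)
      M*F≡ {z} eq = begin
        fromℕ M ℚ.* F p (+ M)                                     ≡⟨ cong (fromℕ M ℚ.*_) eq ⟩
        fromℕ M ℚ.* (sum a ℚ.+ P ℚ.* z)
          ≡⟨ solve 4 (λ m s p z → m :* (s :+ p :* z) := m :* s :+ p :* (m :* z)) refl (fromℕ M) (sum a) P z ⟩
        fromℕ M ℚ.* sum a ℚ.+ P ℚ.* (fromℕ M ℚ.* z)               ≡⟨ cong (ℚ._+ P ℚ.* (fromℕ M ℚ.* z)) M*sum-a ⟩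
        sum (λ i → q i ℚ.* K⁻¹ i) ℚ.+ P ℚ.* sum c ℚ.+ P ℚ.* (fromℕ M ℚ.* z)
                                                                  ≡⟨ solve 4 (λ s p c w → s :+ p :* c :+ p :* w := s :+ p :* (c :+ w)) refl (sum (λ i → q i ℚ.* K⁻¹ i)) P (sum c) (fromℕ M ℚ.* z) ⟩
        sum (λ i → q i ℚ.* K⁻¹ i) ℚ.+ P ℚ.* (sum c ℚ.+ fromℕ M ℚ.* z) ∎

-- Counting lattice points on either side of the line p j = m k.

module _ {n L : ℕ} (m⊥p : Coprime (suc L) (suc n)) where
  private
    p = suc n
    m = suc L

  -- Equality would make p divide m (i + 1), hence i + 1 by coprimality, although 0 < i + 1 < p. So
  -- no pair lies on the line.
  p*[1+j]≢m*[1+i] : ∀ {i j} → i < n → p * suc j ≢ m * suc i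
  p*[1+j]≢m*[1+i] {i} {j} i<n eq =
    ℕ.<⇒≱ i<n (ℕ.s≤s⁻¹ (ℕ.∣⇒≤ (Coprimality.coprime-divisor (Coprimality.sym m⊥p) (subst (p ∣_) eq (ℕ.∣m⇒∣m*n (suc j) ℕ.∣-refl)))))

  -- Read as i + 1 ≤ [p (j + 1) / m] and j + 1 ≤ [m (i + 1) / p], the two tests compare m (i + 1)
  -- with p (j + 1) in opposite directions. Both true would force equality; both false would give
  -- two contradictory strict inequalities.
  <ᵇ-complement : ∀ {i} j → i < n → (i <ᵇ (p * suc j) / m) ≡ not (j <ᵇ (m * suc i) / p)
  <ᵇ-complement {i} j i<n
    with i <ᵇ (p * suc j) / m | ℕ.<ᵇ-reflects-< i ((p * suc j) / m)
       | j <ᵇ (m * suc i) / p | ℕ.<ᵇ-reflects-< j ((m * suc i) / p)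
  ... | true  | _       | false | _       = refl
  ... | false | _       | true  | _       = refl
  ... | true  | ofʸ i<  | true  | ofʸ j<  = contradiction
    (ℕ.≤-antisym (subst (_≤ m * suc i) (ℕ.*-comm (suc j) p) (≤/⇒*≤ j<)) (subst (_≤ p * suc j) (ℕ.*-comm (suc i) m) (≤/⇒*≤ i<)))
    (p*[1+j]≢m*[1+i] i<n)
  ... | false | ofⁿ i≮  | false | ofⁿ j≮  = contradiction
    (ℕ.<-trans
      (subst (p * suc j <_) (ℕ.*-comm (suc i) m) (ℕ.≰⇒> (i≮ ∘ *≤⇒≤/)))
      (subst (m * suc i <_) (ℕ.*-comm (suc j) p) (ℕ.≰⇒> (j≮ ∘ *≤⇒≤/))))
    (ℕ.<-irrefl refl)

  -- Give each pair (j, k) with 1 ≤ j ≤ L and 1 ≤ k ≤ n the weight 1/k. Every pair lies on exactly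
  -- one side of the line, and the two sums on the left collect the two sides; the identity is exact
  -- in ℚ.
  sum-H : ∑₁ L (λ j → H ((p * j) / m)) ℚ.+ ∑[ i < n ] (fromℕ ((m * suc (toℕ i)) / p) ℚ.* 1/1+ (toℕ i))
        ≡ fromℕ L ℚ.* ∑[ i < n ] (1/1+ (toℕ i))
  sum-H = begin
    ∑₁ L (λ j → H ((p * j) / m)) ℚ.+ S
      ≡⟨ cong (ℚ._+ S) (∑₁≡∑ L (λ j → H ((p * j) / m))) ⟩
    ∑[ j < L ] H ((p * suc (toℕ j)) / m) ℚ.+ S
      ≡⟨ cong (ℚ._+ S) (sum-cong-≗ {L} (λ j → trans (H≡∑ ((p * suc (toℕ j)) / m)) (sum-extend (bound₁ j) 1/1+_))) ⟩
    ∑[ j < L ] ∑[ i < n ] (𝟙 (toℕ i <ᵇ (p * suc (toℕ j)) / m) ℚ.* 1/1+ (toℕ i)) ℚ.+ S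
      ≡⟨ cong (ℚ._+ S) (∑-comm {L} {n} (λ j i → 𝟙 (toℕ i <ᵇ (p * suc (toℕ j)) / m) ℚ.* 1/1+ (toℕ i))) ⟩
    ∑[ i < n ] ∑[ j < L ] (𝟙 (toℕ i <ᵇ (p * suc (toℕ j)) / m) ℚ.* 1/1+ (toℕ i)) ℚ.+ S
      ≡⟨ cong (ℚ._+ S) (sum-cong-≗ {n} inner) ⟩
    ∑[ i < n ] ((fromℕ L ℚ.- s i) ℚ.* 1/1+ (toℕ i)) ℚ.+ S
      ≡⟨ ∑-distrib-+ {n} (λ i → (fromℕ L ℚ.- s i) ℚ.* 1/1+ (toℕ i)) (λ i → s i ℚ.* 1/1+ (toℕ i)) ⟨
    ∑[ i < n ] ((fromℕ L ℚ.- s i) ℚ.* 1/1+ (toℕ i) ℚ.+ s i ℚ.* 1/1+ (toℕ i))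
      ≡⟨ sum-cong-≗ {n} (λ i → solve 3 (λ l s x → (l :- s) :* x :+ s :* x := l :* x) refl (fromℕ L) (s i) (1/1+ (toℕ i))) ⟩
    ∑[ i < n ] (fromℕ L ℚ.* 1/1+ (toℕ i))
      ≡⟨ *-distribˡ-sum {n} (fromℕ L) (λ i → 1/1+ (toℕ i)) ⟨
    fromℕ L ℚ.* ∑[ i < n ] (1/1+ (toℕ i)) ∎
    where
    open ≡-Reasoning
    open +-*-Solver
    s : Fin n → ℚ
    s i = fromℕ ((m * suc (toℕ i)) / p)
    S = ∑[ i < n ] (s i ℚ.* 1/1+ (toℕ i))
    -- From j < m and k < p both floors stay within the rectangle, so restricting to it loses no
    -- terms.
    bound₁ : ∀ (j : Fin L) → (p * suc (toℕ j)) / m ≤ n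
    bound₁ j = ℕ.s≤s⁻¹ (ℕ.m<n*o⇒m/o<n (ℕ.*-monoʳ-< p (s≤s (Fin.toℕ<n j))))
    bound₂ : ∀ (i : Fin n) → (m * suc (toℕ i)) / p ≤ L
    bound₂ i = ℕ.s≤s⁻¹ (ℕ.m<n*o⇒m/o<n (ℕ.*-monoʳ-< m (s≤s (Fin.toℕ<n i))))
    inner : ∀ i → ∑[ j < L ] (𝟙 (toℕ i <ᵇ (p * suc (toℕ j)) / m) ℚ.* 1/1+ (toℕ i)) ≡ (fromℕ L ℚ.- s i) ℚ.* 1/1+ (toℕ i)
    inner i = begin
      ∑[ j < L ] (𝟙 (toℕ i <ᵇ (p * suc (toℕ j)) / m) ℚ.* x)
        ≡⟨ *-distribʳ-sum {L} x (λ j → 𝟙 (toℕ i <ᵇ (p * suc (toℕ j)) / m)) ⟨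
      ∑[ j < L ] 𝟙 (toℕ i <ᵇ (p * suc (toℕ j)) / m) ℚ.* x
        ≡⟨ cong (ℚ._* x) (sum-cong-≗ {L} (λ j → trans (cong 𝟙 (<ᵇ-complement (toℕ j) (Fin.toℕ<n i))) (𝟙-not (toℕ j <ᵇ (m * suc (toℕ i)) / p)))) ⟩
      ∑[ j < L ] (1ℚ ℚ.- 𝟙 (toℕ j <ᵇ (m * suc (toℕ i)) / p)) ℚ.* x
        ≡⟨ cong (ℚ._* x) (sum-≮ (bound₂ i)) ⟩
      (fromℕ L ℚ.- s i) ℚ.* x ∎
      where x = 1/1+ (toℕ i)

-- Passing from m to M = m + t p.

module _ {n m M : ℕ} (M≡ : M ≡ m ℕ.+ M / suc n * suc n) where
  private
    p = suc n
    t = M / suc n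

  quotient-shift : ∀ k → (M * k) / p ≡ (m * k) / p ℕ.+ t * k
  quotient-shift k = begin
    (M * k) / p
      ≡⟨ ℕ./-congˡ {o = p} (trans (cong (_* k) M≡) (solve 4 (λ m t p k → (m :+ t :* p) :* k := m :* k :+ t :* k :* p) refl m t p k)) ⟩
    (m * k ℕ.+ t * k * p) / p          ≡⟨ ℕ.+-distrib-/-∣ʳ (m * k) (ℕ.divides-refl (t * k)) ⟩
    (m * k) / p ℕ.+ t * k * p / p      ≡⟨ cong ((m * k) / p ℕ.+_) (ℕ.m*n/n≡m (t * k) p) ⟩
    (m * k) / p ℕ.+ t * k              ∎
    where
    open ≡-Reasoning
    open ℕ-Solver

  -- The extra t k in each floor cancels against 1/k, leaving t for each of the n = p - 1 indices.
  sum-quotient-shift : ∑[ i < n ] (fromℕ ((M * suc (toℕ i)) / p) ℚ.* 1/1+ (toℕ i))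
    ≡ ∑[ i < n ] (fromℕ ((m * suc (toℕ i)) / p) ℚ.* 1/1+ (toℕ i)) ℚ.+ fromℕ n ℚ.* fromℕ t
  sum-quotient-shift = begin
    ∑[ i < n ] (fromℕ ((M * suc (toℕ i)) / p) ℚ.* 1/1+ (toℕ i))
      ≡⟨ sum-cong-≗ {n} (λ i → term (toℕ i)) ⟩
    ∑[ i < n ] (fromℕ ((m * suc (toℕ i)) / p) ℚ.* 1/1+ (toℕ i) ℚ.+ fromℕ t)
      ≡⟨ ∑-distrib-+ {n} (λ i → fromℕ ((m * suc (toℕ i)) / p) ℚ.* 1/1+ (toℕ i)) (λ _ → fromℕ t) ⟩
    ∑[ i < n ] (fromℕ ((m * suc (toℕ i)) / p) ℚ.* 1/1+ (toℕ i)) ℚ.+ ∑[ i < n ] (fromℕ t)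
      ≡⟨ cong (∑[ i < n ] (fromℕ ((m * suc (toℕ i)) / p) ℚ.* 1/1+ (toℕ i)) ℚ.+_) (sum-const n (fromℕ t)) ⟩
    ∑[ i < n ] (fromℕ ((m * suc (toℕ i)) / p) ℚ.* 1/1+ (toℕ i)) ℚ.+ fromℕ n ℚ.* fromℕ t ∎
    where
    open ≡-Reasoning
    term : ∀ k → fromℕ ((M * suc k) / p) ℚ.* 1/1+ k ≡ fromℕ ((m * suc k) / p) ℚ.* 1/1+ k ℚ.+ fromℕ t
    term k = begin
      fromℕ ((M * suc k) / p) ℚ.* x             ≡⟨ cong (λ w → fromℕ w ℚ.* x) (quotient-shift (suc k)) ⟩
      fromℕ (s ℕ.+ t * suc k) ℚ.* x
        ≡⟨ cong (ℚ._* x) (trans (fromℕ-+ s (t * suc k)) (cong (fromℕ s ℚ.+_) (fromℕ-* t (suc k)))) ⟩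
      (fromℕ s ℚ.+ fromℕ t ℚ.* fromℕ (suc k)) ℚ.* x
        ≡⟨ solve 4 (λ s t k x → (s :+ t :* k) :* x := s :* x :+ t :* (k :* x)) refl (fromℕ s) (fromℕ t) (fromℕ (suc k)) x ⟩
      fromℕ s ℚ.* x ℚ.+ fromℕ t ℚ.* (fromℕ (suc k) ℚ.* x)
        ≡⟨ cong (λ w → fromℕ s ℚ.* x ℚ.+ fromℕ t ℚ.* w) (1+k*1/1+k≡1 k) ⟩
      fromℕ s ℚ.* x ℚ.+ fromℕ t ℚ.* 1ℚ          ≡⟨ cong (fromℕ s ℚ.* x ℚ.+_) (ℚ.*-identityʳ (fromℕ t)) ⟩
      fromℕ s ℚ.* x ℚ.+ fromℕ t                 ∎
      where
      open +-*-Solver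
      x = 1/1+ k
      s = (m * suc k) / p

-- The residue modulo 4 rules out 0 and 2; the number 1 has the right residue and is ruled out by
-- primality.
p%4≡1⇒2<p : ∀ {p} → Prime p → p % 4 ≡ 1 → 2 < p
p%4≡1⇒2<p {suc (suc (suc _))} _       _ = s≤s (s≤s (s≤s z≤n))
p%4≡1⇒2<p {1}                 (prime {{()}} _) _

-- Assembling the congruence.

theorem3p7 : (p m M : ℕ) .{{_ : NonZero p}} .{{_ : NonZero m}} .{{_ : NonZero M}} →
    Prime p → p % 4 ≡ 1 →
    m < p → QuadraticNonResidue p m →
    M % p ≡ m % p →
    ℚ.- (fromℕ M ℚ.* F p (+ M)) ≡ fromℕ (M / p) ℚ.+ ∑₁ (m ∸ 1) (λ j → H ((p * j) / m)) [mod p ]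
theorem3p7 p@(suc n) m@(suc L) M p-prime p%4≡1 m<p (m⊥p , _) M%p≡m%p =
  combine (lerch M M⊥p) (harmonic-sum (p%4≡1⇒2<p p-prime p%4≡1))
  where
  open ModPrime p-prime
  open Localization p
  open +-*-Solver
  open ≡-Reasoning

  M≡ : M ≡ m ℕ.+ M / p * p
  M≡ = trans (ℕ.m≡m%n+[m/n]*n M p) (cong (ℕ._+ M / p * p) (trans M%p≡m%p (ℕ.m<n⇒m%n≡m m<p)))

  M⊥p : Coprime M p
  M⊥p {d} (d∣M , d∣p) = m⊥p (ℕ.∣m+n∣m⇒∣n d∣tp+m (ℕ.∣n⇒∣m*n (M / p) d∣p) , d∣p)
    where
    d∣tp+m : d ∣ M / p * p ℕ.+ m
    d∣tp+m = subst (d ∣_) (trans M≡ (ℕ.+-comm m (M / p * p))) d∣M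

  t l ΣH S Q x y : ℚ
  t  = fromℕ (M / p)
  l  = fromℕ L
  ΣH = ∑₁ L (λ j → H ((p * j) / m))
  S  = ∑[ i < n ] (fromℕ ((m * suc (toℕ i)) / p) ℚ.* 1/1+ (toℕ i))
  Q  = ∑[ i < n ] (fromℕ ((M * suc (toℕ i)) / p) ℚ.* 1/1+ (toℕ i))
  x  = ℚ.- (fromℕ M ℚ.* F p (+ M))
  y  = t ℚ.+ ΣH

  x∈ : Integral x
  x∈ = neg-integral (*-integral (fromℕ-integral M) (F-integral M M⊥p))

  combine : ∃[ z ] (Integral z × fromℕ M ℚ.* F p (+ M) ≡ Q ℚ.+ P ℚ.* z) →
            ∃[ z ] (Integral z × sum K⁻¹ ≡ P ℚ.* z) →
            x ≡ y [mod p ]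
  combine (z₁ , z₁∈ , M*F≡) (z₂ , z₂∈ , sum-K⁻¹≡) = ∈ℤ₍p₎ x∈ , ∈ℤ₍p₎ y∈ , w , ∈ℤ₍p₎ w∈ , x-y≡P*w
    where
    -- The three parts come from t + (p - 1) t = p t, the error in Lerch's congruence, and L times
    -- the sum of the 1/k.
    w : ℚ
    w = ℚ.- (t ℚ.+ z₁ ℚ.+ l ℚ.* z₂)

    w∈ : Integral w
    w∈ = neg-integral
      (+-integral (+-integral (fromℕ-integral (M / p)) z₁∈) (*-integral (fromℕ-integral L) z₂∈))

    x-y≡P*w : x ℚ.- y ≡ P ℚ.* w
    x-y≡P*w = begin
      x ℚ.- y
        ≡⟨ cong (λ v → ℚ.- v ℚ.- y) (trans M*F≡ (cong (ℚ._+ P ℚ.* z₁) (sum-quotient-shift M≡))) ⟩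
      ℚ.- (S ℚ.+ fromℕ n ℚ.* t ℚ.+ P ℚ.* z₁) ℚ.- y
        -- Regrouped so that the multiples of t combine to p t and ΣH + S becomes the left side of
        -- `sum-H`.
        ≡⟨ solve 5 (λ s n t u h → :- (s :+ n :* t :+ u) :- (t :+ h)
             := :- ((con 1ℚ :+ n) :* t :+ u :+ (h :+ s))) refl S (fromℕ n) t (P ℚ.* z₁) ΣH ⟩
      ℚ.- ((1ℚ ℚ.+ fromℕ n) ℚ.* t ℚ.+ P ℚ.* z₁ ℚ.+ (ΣH ℚ.+ S))
        ≡⟨ cong₂ (λ u v → ℚ.- (u ℚ.* t ℚ.+ P ℚ.* z₁ ℚ.+ v))
             (sym (fromℕ-+ 1 n)) (trans (sum-H {n} m⊥p) (cong (l ℚ.*_) sum-K⁻¹≡)) ⟩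
      ℚ.- (P ℚ.* t ℚ.+ P ℚ.* z₁ ℚ.+ l ℚ.* (P ℚ.* z₂))
        ≡⟨ solve 5 (λ p t z l u → :- (p :* t :+ p :* z :+ l :* (p :* u))
             := p :* :- (t :+ z :+ l :* u)) refl P t z₁ l z₂ ⟩
      P ℚ.* w ∎

    -- Since y = x - p w, integrality of y is inherited from x and w.
    y∈ : Integral y
    y∈ = subst Integral y≡ (+-integral x∈ (neg-integral (*-integral (fromℕ-integral p) w∈)))
      where
      y≡ : x ℚ.- P ℚ.* w ≡ y
      y≡ = trans (cong (λ v → x ℚ.- v) (sym x-y≡P*w)) (solve 2 (λ x y → x :- (x :- y) := y) refl x y)
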